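{- Let $r \ge 2$, let $d_i \ge 2$ be integers and $D_i = [d_i]$ for $i \in [r]$. Let $c_i : D_i \to \mathbf{R}_+$ for $i \in [r]$ and $c_{ij} : D_i \times D_j \to \mathbf{R}_+\cup\{+\infty\}$ for distinct $i,j \in [r]$ with $c_{ij}(a,b) = c_{ji}(b,a)$, and let $$f(x_1,\dots,x_r) = \sum_{i\in[r]} c_i(x_i) + \sum_{1\le i<j\le r} c_{ij}(x_i,x_j).$$ Let $U = \{(i,a) : i \in [r],\ a \in D_i\}$ and define $H = (h_{(i,a),(j,b)})$, indexed by unordered pairs of distinct elements of $U$, by $h_{(i,a),(j,b)} = c_{ij}(a,b)$ if $i \ne j$ and $h_{(i,a),(j,b)}$ undefined if $i = j$. Then $H$ is M${}^\natural$-convex completable if and only if $f$ satisfies the joint winner property and is Z-free.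
   Context: Conventions: $a<+\infty$, $a+(+\infty)=+\infty$ for $a\in\mathbf{R}$, $0\cdot(+\infty)=0$; $\mathbf{R}_+$ is the set of nonnegative reals. $f$ satisfies the joint winner property (JWP) if $c_{ij}(a,b) \ge \min\{c_{jk}(b,c), c_{ik}(a,c)\}$ for all distinct $i,j,k\in[r]$ and all $a\in D_i, b\in D_j, c\in D_k$. A function $f$ with the JWP is Z-free if for all distinct $i,j \in [r]$, all distinct $a,b \in D_i$ and all distinct $c,d \in D_j$, the minimum of the four values $c_{ij}(a,c), c_{ij}(a,d), c_{ij}(b,c), c_{ij}(b,d)$ is attained by at least two of these four entries. For a finite index set $N$, a function $g : \{0,1\}^N \to \mathbf{R}\cup\{+\infty\}$ is M${}^\natural$-convex if for all $x,y$ and all $u$ with $x_u > y_u$ there exists $v \in \{v : y_v > x_v\}\cup\{0\}$ with $g(x)+g(y) \ge g(x-\chi_u+\chi_v)+g(y+\chi_u-\chi_v)$ ($\chi_u$ the unit vector, $\chi_0=0$). A family $H$ of entries indexed by unordered pairs of distinct elements of $N$, each either in $\mathbf{R}\cup\{+\infty\}$ or undefined, is M${}^\natural$-convex completable if values in $\mathbf{R}\cup\{+\infty\}$ can be assigned to the undefined entries so that, for some real numbers $(h_u)_{u\in N}$, the function $x \mapsto \sum_u h_u x_u + \sum_{\{u,v\}} h_{uv}x_ux_v$ on $\{0,1\}^N$ is M${}^\natural$-convex. -}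

module Defs where

open import Level using (0ℓ)
open import Data.Bool using (Bool; true; false; if_then_else_; _∧_)
open import Data.Nat as ℕ using (ℕ)
open import Data.Fin using (Fin)
open import Data.Fin.Properties using () renaming (_≟_ to _≟F_)
open import Data.List using (List; []; _∷_; map; concatMap; foldr)
open import Data.List.Base using (allFin)
open import Data.Product using (Σ; ∃; ∃-syntax; _×_; _,_; proj₁; proj₂)
open import Data.Product.Properties using (≡-dec)
open import Data.Sum using (_⊎_)
open import Relation.Nullary using (¬_; Dec; yes; no)
open import Relation.Binary using (Rel; Decidable; DecidableEquality)
open import Relation.Binary.Structures using (IsTotalOrder)
open import Relation.Binary.PropositionalEquality using (_≡_; _≢_)
open import Algebra.Structures using (IsCommutativeRing)

-- An axiomatisation of the real numbers: a Dedekind-complete ordered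
-- field (equality is propositional).  The order is assumed decidable,
-- which holds for the (classical) real numbers.

record Reals : Set₁ where
  infixl 6 _+_
  infixl 7 _*_
  infix  4 _≤_
  field
    ℝ    : Set
    _+_  : ℝ → ℝ → ℝ
    _*_  : ℝ → ℝ → ℝ
    -_   : ℝ → ℝ
    0ℝ   : ℝ
    1ℝ   : ℝ
    _≤_  : Rel ℝ 0ℓ
    isCommutativeRing : IsCommutativeRing _≡_ _+_ _*_ -_ 0ℝ 1ℝ
    0≢1      : 0ℝ ≢ 1ℝ
    inverse  : ∀ x → x ≢ 0ℝ → ∃[ y ] (x * y ≡ 1ℝ)
    isTotalOrder : IsTotalOrder _≡_ _≤_
    _≤?_     : Decidable _≤_
    +-monoˡ-≤ : ∀ {x y} z → x ≤ y → x + z ≤ y + z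
    *-nonneg  : ∀ {x y} → 0ℝ ≤ x → 0ℝ ≤ y → 0ℝ ≤ x * y
    sup : (P : ℝ → Set) → ∃ P → (∃[ b ] (∀ x → P x → x ≤ b)) →
          ∃[ s ] ((∀ x → P x → x ≤ s) × (∀ b → (∀ x → P x → x ≤ b) → s ≤ b))

module WithReals (R : Reals) where
  open Reals R public

  data Ext : Set where
    fin : ℝ → Ext
    ∞   : Ext

  infixl 6 _⊕_
  _⊕_ : Ext → Ext → Ext
  fin a ⊕ fin b = fin (a + b)
  fin _ ⊕ ∞     = ∞
  ∞     ⊕ _     = ∞

  infix 4 _≤E_
  data _≤E_ : Ext → Ext → Set where
    fin≤fin : ∀ {a b} → a ≤ b → fin a ≤E fin b
    _≤∞     : ∀ x → x ≤E ∞

  _≤E?_ : Decidable _≤E_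
  fin a ≤E? fin b with a ≤? b
  ... | yes p = yes (fin≤fin p)
  ... | no ¬p = no λ { (fin≤fin q) → ¬p q }
  fin a ≤E? ∞ = yes (fin a ≤∞)
  ∞ ≤E? fin b = no λ ()
  ∞ ≤E? ∞ = yes (∞ ≤∞)

  minE : Ext → Ext → Ext
  minE x y with x ≤E? y
  ... | yes _ = x
  ... | no  _ = y

  -- Problem data: r variables, domains D i = Fin (d i),
  -- unary costs c₁ i : D i → ℝ, binary costs c₂ i j : D i → D j → Ext
  -- (the values of c₂ i i are never used).

  module Problem {r : ℕ} (d : Fin r → ℕ)
                 (c₂ : (i j : Fin r) → Fin (d i) → Fin (d j) → Ext) where

    JWP : Set
    JWP = (i j k : Fin r) → i ≢ j → j ≢ k → i ≢ k →
          (a : Fin (d i)) (b : Fin (d j)) (c : Fin (d k)) →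
          minE (c₂ j k b c) (c₂ i k a c) ≤E c₂ i j a b

    four : ∀ {i j} → Fin (d i) → Fin (d i) → Fin (d j) → Fin (d j) → Fin 4 → Ext
    four {i} {j} a b c e Fin.zero = c₂ i j a c
    four {i} {j} a b c e (Fin.suc Fin.zero) = c₂ i j a e
    four {i} {j} a b c e (Fin.suc (Fin.suc Fin.zero)) = c₂ i j b c
    four {i} {j} a b c e (Fin.suc (Fin.suc (Fin.suc Fin.zero))) = c₂ i j b e

    min4 : (Fin 4 → Ext) → Ext
    min4 v = minE (minE (v Fin.zero) (v (Fin.suc Fin.zero)))
                  (minE (v (Fin.suc (Fin.suc Fin.zero)))
                        (v (Fin.suc (Fin.suc (Fin.suc Fin.zero)))))

    -- Z-freeness (of a function with the JWP)
    ZFree : Set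
    ZFree = (i j : Fin r) → i ≢ j →
            (a b : Fin (d i)) → a ≢ b → (c e : Fin (d j)) → c ≢ e →
            ∃[ p ] ∃[ q ] (p ≢ q ×
              four a b c e p ≡ min4 (four a b c e) ×
              four a b c e q ≡ min4 (four a b c e))

    U : Set
    U = Σ (Fin r) (λ i → Fin (d i))

    _≟U_ : DecidableEquality U
    _≟U_ = ≡-dec _≟F_ _≟F_

    Ulist : List U
    Ulist = concatMap (λ i → map (i ,_) (allFin (d i))) (allFin r)

  module _ {N : Set} (_≟N_ : DecidableEquality N) where

    set : (N → Bool) → N → Bool → N → Bool
    set x u b w with w ≟N u
    ... | yes _ = b
    ... | no  _ = x w

    MnatConvex : ((N → Bool) → Ext) → Set
    MnatConvex g = (x y : N → Bool) (u : N) → x u ≡ true → y u ≡ false →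
      (g (set x u false) ⊕ g (set y u true) ≤E g x ⊕ g y)
      ⊎ (∃[ v ] (y v ≡ true × x v ≡ false ×
          (g (set (set x u false) v true) ⊕ g (set (set y u true) v false)
             ≤E g x ⊕ g y)))

  sumE : {A : Set} → (A → Ext) → List A → Ext
  sumE f = foldr (λ a s → f a ⊕ s) (fin 0ℝ)

  pairs : {A : Set} → List A → List (A × A)
  pairs []       = []
  pairs (a ∷ as) = map (a ,_) as Data.List.++ pairs as

  -- x ↦ Σ_u h₁ u x_u + Σ_{u,v} h₂ u v x_u x_v  (with 0·(+∞) = 0),
  -- where the second sum runs over unordered pairs of the enumeration
  quadFun : {N : Set} → List N → (N → ℝ) → (N → N → Ext) → (N → Bool) → Ext
  quadFun Ns h₁ h₂ x =
    sumE (λ u → if x u then fin (h₁ u) else fin 0ℝ) Ns ⊕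
    sumE (λ p → if x (proj₁ p) ∧ x (proj₂ p) then h₂ (proj₁ p) (proj₂ p) else fin 0ℝ)
         (pairs Ns)

  module _ {r : ℕ} (d : Fin r → ℕ)
           (c₂ : (i j : Fin r) → Fin (d i) → Fin (d j) → Ext) where
    open Problem d c₂

    MnatCompletable : Set
    MnatCompletable =
      ∃[ h₂ ] ((∀ (u v : U) → h₂ u v ≡ h₂ v u) ×
               (∀ (i j : Fin r) → i ≢ j → (a : Fin (d i)) (b : Fin (d j)) →
                   h₂ (i , a) (j , b) ≡ c₂ i j a b) ×
               ∃[ h₁ ] MnatConvex _≟U_ (quadFun Ulist h₁ h₂))

{-# OPTIONS --safe #-}
module Submission where

-- A quadratic function with nonnegative coefficients h is M♮-convex exactly when h is
-- anti-ultrametric: h u v ≥ min (h u w, h w v).  Necessity is the exchange axiom for {u,v} and {w}.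
-- For sufficiency, exchange u ∈ x \ y as follows: take a closest pair (p , q), i.e. h p q maximal,
-- between x \ y and y \ x.  If p = u, exchanging u with q works.  Otherwise discarding p and q only
-- makes the required inequality harder, and one recurses; once y \ x is empty, u is just moved.
-- An anti-ultrametric on a complete multipartite graph extends to the missing pairs iff in every
-- triangle (JWP) and every 4-cycle (Z-freeness) no entry is a strict minimum; the extension is
-- h u v = max over w of min (c u w, c v w).

open import Defs
open import Data.Nat using (ℕ; zero; suc) renaming (_≤_ to _≤ℕ_)
import Data.Nat.Properties as ℕₚ
open import Data.Fin using (Fin; zero; suc)
open import Function.Bundles using (_⇔_; mk⇔)
open import Level using (0ℓ)
open import Algebra.Bundles using (CommutativeMonoid)
open import Algebra.Structures using (IsCommutativeRing)
import Algebra.Construct.NaturalChoice.Min as Min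
import Algebra.Properties.CommutativeSemigroup as CommutativeSemigroupProperties
open import Data.Bool using (Bool; true; false; if_then_else_; not; _∧_; T?)
open import Data.Bool.Properties using (∧-comm)
open import Data.Fin.Properties using () renaming (_≟_ to _≟F_)
open import Data.List using (List; []; _∷_; _++_; map; filterᵇ; length; cartesianProduct; allFin)
import Data.List.Extrema as Extrema
open import Data.List.Membership.Propositional using (_∈_; lose)
open import Data.List.Membership.Propositional.Properties
  using (∈-∃++; ∈-cartesianProduct⁺; ∈-cartesianProduct⁻; ∈-map⁺; ∈-map⁻; ∈-allFin; ∈-filter⁻; ∈-concatMap⁺)
open import Data.List.Properties using (map-cong)
open import Data.List.Relation.Unary.All as All using ([]; _∷_)
import Data.List.Relation.Unary.All.Properties as Allₚ
open import Data.List.Relation.Unary.AllPairs as AllPairs using ([]; _∷_)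
import Data.List.Relation.Unary.AllPairs.Properties as AllPairsₚ
open import Data.List.Relation.Unary.Any using (here; there)
open import Data.List.Relation.Unary.Unique.Propositional using (Unique)
import Data.List.Relation.Unary.Unique.Propositional.Properties as Uniqueₚ
open import Data.List.Relation.Binary.Disjoint.Propositional using (Disjoint)
open import Data.List.Relation.Binary.Permutation.Propositional
  using (_↭_; refl; prep; swap; trans; ↭-sym; ↭-trans; ↭-reflexive)
open import Data.List.Relation.Binary.Permutation.Propositional.Properties
  using (shift; drop-∷; ∈-resp-↭; ↭-length; ++⁺ʳ)
open import Data.Product using (_×_; ∃-syntax; ∃₂; _,_; proj₁; proj₂)
open import Data.Sum using (_⊎_; inj₁; inj₂)
open import Function using (id; _∘_; case_of_)
open import Relation.Binary using (TotalOrder; IsTotalOrder; DecidableEquality)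
open import Relation.Binary.PropositionalEquality
  using (_≡_; _≢_; refl; sym; cong; cong₂; subst; subst₂; isEquivalence; module ≡-Reasoning)
  renaming (trans to ≡-trans)
open import Relation.Nullary using (yes; no; contradiction)

-- Permutations and Boolean filters of lists.

module _ {A : Set} where

  ∈⇒↭∷ : ∀ {x : A} {xs} → x ∈ xs → ∃[ ys ] xs ↭ x ∷ ys
  ∈⇒↭∷ {x} x∈xs with ys , zs , refl ← ∈-∃++ x∈xs = ys ++ zs , shift x ys zs

  filterᵇ-cong : ∀ {x y : A → Bool} as → (∀ {a} → a ∈ as → x a ≡ y a) → filterᵇ x as ≡ filterᵇ y as
  filterᵇ-cong [] eq = refl
  filterᵇ-cong {x} {y} (a ∷ as) eq with x a | y a | eq (here refl)
  ... | true  | true  | _ = cong (a ∷_) (filterᵇ-cong as (eq ∘ there))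
  ... | false | false | _ = filterᵇ-cong as (eq ∘ there)

  filterᵇ-split : ∀ (x y : A → Bool) as →
    filterᵇ x as ↭ filterᵇ (λ a → x a ∧ not (y a)) as ++ filterᵇ (λ a → x a ∧ y a) as
  filterᵇ-split x y [] = refl
  filterᵇ-split x y (a ∷ as) with x a | y a
  ... | false | _     = filterᵇ-split x y as
  ... | true  | false = prep a (filterᵇ-split x y as)
  ... | true  | true  = ↭-trans (prep a (filterᵇ-split x y as)) (↭-sym (shift a _ _))

module _ (R : Reals) where
  open WithReals R
  module ℝ = IsCommutativeRing isCommutativeRing
  module ≤ = IsTotalOrder isTotalOrder

  -- Order and addition on the reals and on the reals with +∞.

  +-mono-≤ : ∀ {a b c d} → a ≤ b → c ≤ d → a + c ≤ b + d
  +-mono-≤ {a} {b} {c} {d} p q = ≤.trans (+-monoˡ-≤ c p)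
    (subst₂ _≤_ (ℝ.+-comm c b) (ℝ.+-comm d b) (+-monoˡ-≤ b q))

  +-cancelˡ-≤ : ∀ c {a b} → c + a ≤ c + b → a ≤ b
  +-cancelˡ-≤ c {a} {b} p = subst₂ _≤_ (lemma a) (lemma b) (+-monoˡ-≤ (- c) p)
    where
    open ≡-Reasoning
    lemma : ∀ x → (c + x) + - c ≡ x
    lemma x = begin
      (c + x) + - c ≡⟨ cong (_+ - c) (ℝ.+-comm c x) ⟩
      (x + c) + - c ≡⟨ ℝ.+-assoc x c (- c) ⟩
      x + (c + - c) ≡⟨ cong (x +_) (ℝ.-‿inverseʳ c) ⟩
      x + 0ℝ        ≡⟨ ℝ.+-identityʳ x ⟩
      x             ∎

  ≤E-refl : ∀ {x} → x ≤E x
  ≤E-refl {fin a} = fin≤fin ≤.refl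
  ≤E-refl {∞}     = ∞ ≤∞

  ≤E-trans : ∀ {x y z} → x ≤E y → y ≤E z → x ≤E z
  ≤E-trans (fin≤fin p) (fin≤fin q) = fin≤fin (≤.trans p q)
  ≤E-trans p           (_ ≤∞)      = _ ≤∞

  ≤E-antisym : ∀ {x y} → x ≤E y → y ≤E x → x ≡ y
  ≤E-antisym (fin≤fin p) (fin≤fin q) = cong fin (≤.antisym p q)
  ≤E-antisym (_ ≤∞)      (_ ≤∞)      = refl

  ≤E-total : ∀ x y → x ≤E y ⊎ y ≤E x
  ≤E-total x       ∞       = inj₁ (x ≤∞)
  ≤E-total ∞       (fin b) = inj₂ (fin b ≤∞)
  ≤E-total (fin a) (fin b) with ≤.total a b
  ... | inj₁ p = inj₁ (fin≤fin p)
  ... | inj₂ p = inj₂ (fin≤fin p)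

  ≤E-reflexive : ∀ {x y} → x ≡ y → x ≤E y
  ≤E-reflexive refl = ≤E-refl

  ≤E-totalOrder : TotalOrder 0ℓ 0ℓ 0ℓ
  ≤E-totalOrder = record
    { isTotalOrder = record
      { isPartialOrder = record
        { isPreorder = record
          { isEquivalence = isEquivalence ; reflexive = ≤E-reflexive ; trans = ≤E-trans }
        ; antisym = ≤E-antisym }
      ; total = ≤E-total } }

  open Extrema ≤E-totalOrder using (argmax; f[xs]≤f[argmax]; argmax-sel; max; ⊥≤max; xs≤max)
  open Min ≤E-totalOrder using (_⊓_; ⊓-comm; ⊓-glb; x⊓y≤x; x⊓y≤y)

  ⊕-comm : ∀ x y → x ⊕ y ≡ y ⊕ x
  ⊕-comm (fin a) (fin b) = cong fin (ℝ.+-comm a b)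
  ⊕-comm (fin a) ∞       = refl
  ⊕-comm ∞       (fin b) = refl
  ⊕-comm ∞       ∞       = refl

  ⊕-assoc : ∀ x y z → (x ⊕ y) ⊕ z ≡ x ⊕ (y ⊕ z)
  ⊕-assoc (fin a) (fin b) (fin c) = cong fin (ℝ.+-assoc a b c)
  ⊕-assoc (fin a) (fin b) ∞       = refl
  ⊕-assoc (fin a) ∞       z       = refl
  ⊕-assoc ∞       y       z       = refl

  ⊕-identityˡ : ∀ x → fin 0ℝ ⊕ x ≡ x
  ⊕-identityˡ (fin a) = cong fin (ℝ.+-identityˡ a)
  ⊕-identityˡ ∞       = refl

  ⊕-identityʳ : ∀ x → x ⊕ fin 0ℝ ≡ x
  ⊕-identityʳ x = ≡-trans (⊕-comm x _) (⊕-identityˡ x)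

  ⊕-commutativeMonoid : CommutativeMonoid 0ℓ 0ℓ
  ⊕-commutativeMonoid = record
    { isCommutativeMonoid = record
      { isMonoid = record
        { isSemigroup = record
          { isMagma = record { isEquivalence = isEquivalence ; ∙-cong = cong₂ _⊕_ }
          ; assoc = ⊕-assoc }
        ; identity = ⊕-identityˡ , ⊕-identityʳ }
      ; comm = ⊕-comm } }

  open CommutativeSemigroupProperties
    (CommutativeMonoid.commutativeSemigroup ⊕-commutativeMonoid)
    using (interchange; x∙yz≈y∙xz)

  ⊕-mono-≤ : ∀ {x y z w} → x ≤E y → z ≤E w → x ⊕ z ≤E y ⊕ w
  ⊕-mono-≤ (fin≤fin p) (fin≤fin q)       = fin≤fin (+-mono-≤ p q)
  ⊕-mono-≤ (fin≤fin p) (_ ≤∞)            = _ ≤∞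
  ⊕-mono-≤ (_ ≤∞)      _                 = _ ≤∞

  ⊕-cancelˡ-≤ : ∀ c {x y} → fin c ⊕ x ≤E fin c ⊕ y → x ≤E y
  ⊕-cancelˡ-≤ c {fin a} {fin b} (fin≤fin p) = fin≤fin (+-cancelˡ-≤ c p)
  ⊕-cancelˡ-≤ c {x}     {∞}     p           = x ≤∞

  -- Finite sums over lists and over the unordered pairs of a list.

  sumE-++ : ∀ {A : Set} (f : A → Ext) xs ys → sumE f (xs ++ ys) ≡ sumE f xs ⊕ sumE f ys
  sumE-++ f []       ys = sym (⊕-identityˡ _)
  sumE-++ f (x ∷ xs) ys = ≡-trans (cong (f x ⊕_) (sumE-++ f xs ys)) (sym (⊕-assoc (f x) _ _))

  sumE-map : ∀ {A B : Set} (f : B → Ext) (g : A → B) xs → sumE f (map g xs) ≡ sumE (f ∘ g) xs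
  sumE-map f g []       = refl
  sumE-map f g (x ∷ xs) = cong (f (g x) ⊕_) (sumE-map f g xs)

  sumE-zero : ∀ {A : Set} (xs : List A) → sumE (λ _ → fin 0ℝ) xs ≡ fin 0ℝ
  sumE-zero []       = refl
  sumE-zero (x ∷ xs) = ≡-trans (⊕-identityˡ _) (sumE-zero xs)

  sumE-↭ : ∀ {A : Set} (f : A → Ext) {xs ys} → xs ↭ ys → sumE f xs ≡ sumE f ys
  sumE-↭ f refl         = refl
  sumE-↭ f (prep x p)   = cong (f x ⊕_) (sumE-↭ f p)
  sumE-↭ f (swap x y p) =
    ≡-trans (x∙yz≈y∙xz (f x) (f y) _) (cong (λ s → f y ⊕ (f x ⊕ s)) (sumE-↭ f p))
  sumE-↭ f (trans p q)  = ≡-trans (sumE-↭ f p) (sumE-↭ f q)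

  sumE-mono : ∀ {A : Set} {f g : A → Ext} xs → (∀ {x} → x ∈ xs → f x ≤E g x) → sumE f xs ≤E sumE g xs
  sumE-mono []       p = ≤E-refl
  sumE-mono (x ∷ xs) p = ⊕-mono-≤ (p (here refl)) (sumE-mono xs (p ∘ there))

  sumE-filterᵇ : ∀ {A : Set} (f : A → Ext) (x : A → Bool) as →
    sumE (λ a → if x a then f a else fin 0ℝ) as ≡ sumE f (filterᵇ x as)
  sumE-filterᵇ f x []       = refl
  sumE-filterᵇ f x (a ∷ as) with x a
  ... | true  = cong (f a ⊕_) (sumE-filterᵇ f x as)
  ... | false = ≡-trans (⊕-identityˡ _) (sumE-filterᵇ f x as)

  pairSum : {A : Set} → (A → A → Ext) → List A → Ext
  pairSum h []       = fin 0ℝ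
  pairSum h (a ∷ as) = sumE (h a) as ⊕ pairSum h as

  -- Transposing two neighbours replaces the entry `h x y` by `h y x` and permutes the remaining
  -- summands, so symmetry of `h` makes the sum depend only on the underlying multiset.
  pairSum-↭ : ∀ {A : Set} {h : A → A → Ext} → (∀ u v → h u v ≡ h v u) →
    ∀ {xs ys} → xs ↭ ys → pairSum h xs ≡ pairSum h ys
  pairSum-↭ h-sym refl = refl
  pairSum-↭ {h = h} h-sym (prep x p) = cong₂ _⊕_ (sumE-↭ (h x) p) (pairSum-↭ h-sym p)
  pairSum-↭ {h = h} h-sym (swap {xs} {ys} x y p) = begin
    (h x y ⊕ sumE (h x) xs) ⊕ (sumE (h y) xs ⊕ pairSum h xs)
      ≡⟨ interchange (h x y) _ _ _ ⟩
    (h x y ⊕ sumE (h y) xs) ⊕ (sumE (h x) xs ⊕ pairSum h xs)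
      ≡⟨ cong₂ _⊕_ (cong₂ _⊕_ (h-sym x y) (sumE-↭ (h y) p))
                   (cong₂ _⊕_ (sumE-↭ (h x) p) (pairSum-↭ h-sym p)) ⟩
    (h y x ⊕ sumE (h y) ys) ⊕ (sumE (h x) ys ⊕ pairSum h ys) ∎
    where open ≡-Reasoning
  pairSum-↭ h-sym (trans p q) = ≡-trans (pairSum-↭ h-sym p) (pairSum-↭ h-sym q)

  pairSum-filterᵇ : ∀ {A : Set} (h : A → A → Ext) (x : A → Bool) as →
    sumE (λ p → if x (proj₁ p) ∧ x (proj₂ p) then h (proj₁ p) (proj₂ p) else fin 0ℝ) (pairs as)
      ≡ pairSum h (filterᵇ x as)
  pairSum-filterᵇ h x []       = refl
  pairSum-filterᵇ h x (a ∷ as) = ≡-trans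
    (≡-trans (sumE-++ _ (map (a ,_) as) (pairs as)) (cong₂ _⊕_ (sumE-map _ (a ,_) as) (pairSum-filterᵇ h x as)))
    row
    where
    row : sumE (λ b → if x a ∧ x b then h a b else fin 0ℝ) as ⊕ pairSum h (filterᵇ x as)
          ≡ pairSum h (filterᵇ x (a ∷ as))
    row with x a
    ... | true  = cong (_⊕ pairSum h (filterᵇ x as)) (sumE-filterᵇ (h a) x as)
    ... | false = ≡-trans (cong (_⊕ pairSum h (filterᵇ x as)) (sumE-zero as)) (⊕-identityˡ _)

  quadSum : {A : Set} → (A → ℝ) → (A → A → Ext) → List A → Ext
  quadSum h₁ h₂ as = sumE (fin ∘ h₁) as ⊕ pairSum h₂ as

  quadFun≡quadSum : ∀ {A : Set} as (h₁ : A → ℝ) h₂ x → quadFun as h₁ h₂ x ≡ quadSum h₁ h₂ (filterᵇ x as)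
  quadFun≡quadSum as h₁ h₂ x = cong₂ _⊕_
    (sumE-filterᵇ (fin ∘ h₁) x as) (pairSum-filterᵇ h₂ x as)

  quadSum-↭ : ∀ {A : Set} {h₁ : A → ℝ} {h₂ : A → A → Ext} → (∀ u v → h₂ u v ≡ h₂ v u) →
    ∀ {xs ys} → xs ↭ ys → quadSum h₁ h₂ xs ≡ quadSum h₁ h₂ ys
  quadSum-↭ {h₁ = h₁} h₂-sym p = cong₂ _⊕_ (sumE-↭ (fin ∘ h₁) p) (pairSum-↭ h₂-sym p)

  -- No distinctness is required of u, v, w: diagonal entries, which never enter a quadratic
  -- function on {0,1}ᴺ, will be set to ∞.
  AntiUltrametric : {A : Set} → (A → A → Ext) → Set
  AntiUltrametric h = ∀ u v w → h u w ≤E h u v ⊎ h w v ≤E h u v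

  -- The greedy exchange argument on lists.

  module Greedy {A : Set} {h : A → A → Ext} (h-sym : ∀ u v → h u v ≡ h v u)
                (h-nonneg : ∀ u v → fin 0ℝ ≤E h u v) (h-anti : AntiUltrametric h) where

    closest : ∀ x xs y ys → ∃₂ λ p q → p ∈ x ∷ xs × q ∈ y ∷ ys ×
      (∀ {p′ q′} → p′ ∈ x ∷ xs → q′ ∈ y ∷ ys → h p′ q′ ≤E h p q)
    closest x xs y ys = proj₁ best , proj₂ best , proj₁ best∈ , proj₂ best∈ ,
      λ p∈ q∈ → All.lookup (f[xs]≤f[argmax] {f = value} (x , y) candidates) (∈-cartesianProduct⁺ p∈ q∈)
      where
      value = λ (p : A × A) → h (proj₁ p) (proj₂ p)
      candidates = cartesianProduct (x ∷ xs) (y ∷ ys)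
      best = argmax value (x , y) candidates
      best∈ : proj₁ best ∈ x ∷ xs × proj₂ best ∈ y ∷ ys
      best∈ with argmax-sel value (x , y) candidates
      ... | inj₁ eq = subst (_∈ x ∷ xs) (sym (cong proj₁ eq)) (here refl)
                    , subst (_∈ y ∷ ys) (sym (cong proj₂ eq)) (here refl)
      ... | inj₂ m  = ∈-cartesianProduct⁻ (x ∷ xs) (y ∷ ys) m

    -- The anti-ultrametric inequality for `z`, `p` through `q` bounds `h z p` below by the smaller
    -- of `h z q` and `h q p`, which by assumption is `h z q`.
    transferˡ : ∀ {p q z} → h z q ≤E h p q → h z q ≤E h z p
    transferˡ {p} {q} {z} zq≤pq with h-anti z p q
    ... | inj₁ zq≤zp = zq≤zp
    ... | inj₂ qp≤zp = ≤E-trans zq≤pq (subst (_≤E h z p) (h-sym q p) qp≤zp)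

    transferʳ : ∀ {p q z} → h p z ≤E h p q → h z p ≤E h z q
    transferʳ {p} {q} {z} pz≤pq = transferˡ (subst₂ _≤E_ (h-sym p z) (h-sym p q) pz≤pq)

    -- The two alternatives of the exchange axiom, with all terms common to both sides removed: `u`
    -- is moved alone, or it is traded for an element `v` of `ys`. Here `xs` is the part of x minus
    -- y other than `u`, and `ys` is y minus x.
    Exchange : A → List A → List A → Set
    Exchange u xs ys = sumE (h u) ys ≤E sumE (h u) xs
      ⊎ ∃₂ λ v zs → ys ↭ v ∷ zs × sumE (h v) xs ⊕ sumE (h u) zs ≤E sumE (h u) xs ⊕ sumE (h v) zs

    -- Puts a discarded pair `p`, `q` back. If `u` moves alone, the new terms are compared by
    -- `h u q ≤ h u p`; if `u` is traded for `v`, the comparison `h v p ≤ h v q` is added to it.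
    extend : ∀ {u p q xs ws ys zs} → xs ↭ p ∷ ws → ys ↭ q ∷ zs → h u q ≤E h u p →
      (∀ {v} → v ∈ ys → h v p ≤E h v q) → Exchange u ws zs → Exchange u xs ys
    extend {u} xs↭ ys↭ uq≤up _ (inj₁ le) = inj₁
      (subst₂ _≤E_ (sym (sumE-↭ (h u) ys↭)) (sym (sumE-↭ (h u) xs↭)) (⊕-mono-≤ uq≤up le))
    extend {u} {p} {q} {xs} {ws} xs↭ ys↭ uq≤up vp≤vq (inj₂ (v , ts , zs↭ , le)) =
      inj₂ (v , q ∷ ts , ys↭′ , subst₂ _≤E_ (regroup v u) (regroup u v) (⊕-mono-≤ gain le))
      where
      ys↭′ = ↭-trans ys↭ (↭-trans (prep q zs↭) (swap q v refl))
      gain : h v p ⊕ h u q ≤E h u p ⊕ h v q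
      gain = subst (h v p ⊕ h u q ≤E_) (⊕-comm (h v q) (h u p))
        (⊕-mono-≤ (vp≤vq (∈-resp-↭ (↭-sym ys↭′) (here refl))) uq≤up)
      regroup : ∀ a b → (h a p ⊕ h b q) ⊕ (sumE (h a) ws ⊕ sumE (h b) ts)
                        ≡ sumE (h a) xs ⊕ sumE (h b) (q ∷ ts)
      regroup a b = ≡-trans (interchange (h a p) (h b q) _ _)
        (cong (_⊕ sumE (h b) (q ∷ ts)) (sym (sumE-↭ (h a) xs↭)))

    -- The recursion removes an element at an arbitrary position of `ys`, so it runs on the length
    -- `n` rather than on the list.
    exchange : ∀ n u xs ys → length ys ≡ n → Exchange u xs ys
    exchange n u xs [] _ = inj₁ (subst (_≤E sumE (h u) xs) (sumE-zero xs) (sumE-mono xs (λ _ → h-nonneg u _)))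
    exchange (suc n) u xs (y ∷ ys) len with closest u xs y ys
    ... | p , q , p∈ , q∈ , maximal with ∈⇒↭∷ q∈
    ... | zs , ys↭ with p∈
    -- The closest pair starts at `u`: maximality gives, term by term, that `q` is no nearer than
    -- `u` to `xs` and no farther in value than `u` from `zs` in the sense `h u z ≤ h q z`.
    ...   | here refl = inj₂ (q , zs , ys↭ , ⊕-mono-≤
              (sumE-mono xs λ {z} z∈ → subst₂ _≤E_ (h-sym z q) (h-sym z u)
                (transferˡ (maximal (there z∈) q∈)))
              (sumE-mono zs λ {z} z∈ → subst₂ _≤E_ (h-sym z u) (h-sym z q)
                (transferʳ (maximal (here refl) (∈-resp-↭ (↭-sym ys↭) (there z∈))))))
    ...   | there p∈xs with ∈⇒↭∷ p∈xs
    ...     | ws , xs↭ = extend xs↭ ys↭ (transferˡ (maximal (here refl) q∈))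
                (λ v∈ → transferʳ (maximal p∈ v∈))
                (exchange n u ws zs (ℕₚ.suc-injective (≡-trans (sym (↭-length ys↭)) len)))

  -- Changing one coordinate of a 0/1 vector, seen on the list of its support.

  module _ {N : Set} (_≟_ : DecidableEquality N) where

    set-≡ : ∀ x u b → set _≟_ x u b u ≡ b
    set-≡ x u b with u ≟ u
    ... | yes _   = refl
    ... | no  u≢u = contradiction refl u≢u

    set-≢ : ∀ x {u w} b → w ≢ u → set _≟_ x u b w ≡ x w
    set-≢ x {u} {w} b w≢u with w ≟ u
    ... | yes w≡u = contradiction w≡u w≢u
    ... | no  _   = refl

    set-set : ∀ x u b c → x u ≡ c → ∀ w → set _≟_ (set _≟_ x u b) u c w ≡ x w
    set-set x u b c xu≡c w with w ≟ u
    ... | yes refl = sym xu≡c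
    ... | no  w≢u  = set-≢ x b w≢u

    -- Uniqueness of the enumeration ensures that clearing coordinate `u` deletes a single list
    -- entry.
    filterᵇ-remove : ∀ {x u as} → Unique as → u ∈ as → x u ≡ true →
      filterᵇ x as ↭ u ∷ filterᵇ (set _≟_ x u false) as
    filterᵇ-remove {x} {u} {as = _ ∷ as} (u∉ ∷ _) (here refl) xu
      rewrite xu | set-≡ x u false = prep u (↭-reflexive (filterᵇ-cong as
        λ {a} a∈ → sym (set-≢ x false (λ a≡u → All.lookup u∉ a∈ (sym a≡u)))))
    filterᵇ-remove {x} {u} {as = a ∷ as} (a∉ ∷ uniq) (there u∈) xu
      rewrite set-≢ x false (All.lookup a∉ u∈) with x a
    ... | true  = ↭-trans (prep a (filterᵇ-remove uniq u∈ xu)) (swap a u refl)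
    ... | false = filterᵇ-remove uniq u∈ xu

    filterᵇ-insert : ∀ {x u as} → Unique as → u ∈ as → x u ≡ false →
      filterᵇ (set _≟_ x u true) as ↭ u ∷ filterᵇ x as
    filterᵇ-insert {x} {u} {as} uniq u∈ xu = ↭-trans
      (filterᵇ-remove uniq u∈ (set-≡ x u true))
      (prep u (↭-reflexive (filterᵇ-cong as λ {a} _ → set-set x u true false xu a)))

    -- M♮-convexity of quadratic functions and the anti-ultrametric inequality.

    module Quadratic (Ns : List N) (uniq : Unique Ns) (all∈ : ∀ u → u ∈ Ns)
      (h₁ : N → ℝ) (h₂ : N → N → Ext) (h₂-sym : ∀ u v → h₂ u v ≡ h₂ v u) where

      private
        g = quadFun Ns h₁ h₂
        G = quadSum h₁ h₂
        row = λ u as → sumE (h₂ u) as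
        _[_≔_] = set _≟_

      g≡G : ∀ {x as} → filterᵇ x Ns ↭ as → g x ≡ G as
      g≡G {x} p = ≡-trans (quadFun≡quadSum Ns h₁ h₂ x) (quadSum-↭ h₂-sym p)

      G-∷ : ∀ u as → G (u ∷ as) ≡ (fin (h₁ u) ⊕ row u as) ⊕ G as
      G-∷ u as = interchange (fin (h₁ u)) _ _ _

      G-∷-∷ : ∀ u as v bs →
        G (u ∷ as) ⊕ G (v ∷ bs) ≡ (fin (h₁ u + h₁ v) ⊕ (row u as ⊕ row v bs)) ⊕ (G as ⊕ G bs)
      G-∷-∷ u as v bs = begin
        G (u ∷ as) ⊕ G (v ∷ bs)
          ≡⟨ cong₂ _⊕_ (G-∷ u as) (G-∷ v bs) ⟩
        ((fin (h₁ u) ⊕ row u as) ⊕ G as) ⊕ ((fin (h₁ v) ⊕ row v bs) ⊕ G bs)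
          ≡⟨ interchange _ (G as) _ _ ⟩
        ((fin (h₁ u) ⊕ row u as) ⊕ (fin (h₁ v) ⊕ row v bs)) ⊕ (G as ⊕ G bs)
          ≡⟨ cong (_⊕ (G as ⊕ G bs)) (interchange (fin (h₁ u)) _ _ _) ⟩
        (fin (h₁ u + h₁ v) ⊕ (row u as ⊕ row v bs)) ⊕ (G as ⊕ G bs) ∎
        where open ≡-Reasoning

      -- The linear terms of `u` and `v` and the values `G as`, `G bs` occur on both sides, so only
      -- the two rows compete. The argument adds common terms and never cancels, hence it tolerates
      -- +∞.
      G-swap-≤ : ∀ {u v} as bs → row v as ⊕ row u bs ≤E row u as ⊕ row v bs →
        G (v ∷ as) ⊕ G (u ∷ bs) ≤E G (u ∷ as) ⊕ G (v ∷ bs)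
      G-swap-≤ {u} {v} as bs le = subst₂ _≤E_ (sym (G-∷-∷ v as u bs)) (sym (G-∷-∷ u as v bs))
        (⊕-mono-≤ (⊕-mono-≤ (≤E-reflexive (cong fin (ℝ.+-comm (h₁ v) (h₁ u)))) le) ≤E-refl)

      G-move-≤ : ∀ {u} as bs → row u bs ≤E row u as → G as ⊕ G (u ∷ bs) ≤E G (u ∷ as) ⊕ G bs
      G-move-≤ {u} as bs le = subst₂ _≤E_
        (≡-trans (x∙yz≈y∙xz _ (G as) _) (cong (G as ⊕_) (sym (G-∷ u bs))))
        (≡-trans (sym (⊕-assoc _ (G as) (G bs))) (cong (_⊕ G bs) (sym (G-∷ u as))))
        (⊕-mono-≤ (⊕-mono-≤ (≤E-refl {fin (h₁ u)}) le) ≤E-refl)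

      antiUltrametric⇒MnatConvex : (∀ u v → fin 0ℝ ≤E h₂ u v) → AntiUltrametric h₂ →
        MnatConvex _≟_ g
      antiUltrametric⇒MnatConvex nonneg anti x y u xu yu =
        convex (Greedy.exchange h₂-sym nonneg anti _ u A B refl)
        where
        X = x [ u ≔ false ]
        Y = y [ u ≔ true ]
        -- As y does not contain `u`, these are x minus y without `u`, y minus x, and the
        -- intersection of x and y. The rows of `u` and `v` over `C` contribute equally to both
        -- sides of the exchange inequality.
        A = filterᵇ (λ a → X a ∧ not (y a)) Ns
        B = filterᵇ (λ a → y a ∧ not (X a)) Ns
        C = filterᵇ (λ a → X a ∧ y a) Ns
        X↭ : filterᵇ X Ns ↭ A ++ C
        X↭ = filterᵇ-split X y Ns
        x↭ : filterᵇ x Ns ↭ u ∷ A ++ C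
        x↭ = ↭-trans (filterᵇ-remove uniq (all∈ u) xu) (prep u X↭)
        y↭ : filterᵇ y Ns ↭ B ++ C
        y↭ = ↭-trans (filterᵇ-split y X Ns)
          (↭-reflexive (cong (B ++_) (filterᵇ-cong Ns λ {a} _ → ∧-comm (y a) (X a))))
        Y↭ : filterᵇ Y Ns ↭ u ∷ B ++ C
        Y↭ = ↭-trans (filterᵇ-insert uniq (all∈ u) yu) (prep u y↭)
        convex : Greedy.Exchange h₂-sym nonneg anti u A B → _
        convex (inj₁ le) = inj₁ (subst₂ _≤E_
          (sym (cong₂ _⊕_ (g≡G X↭) (g≡G Y↭))) (sym (cong₂ _⊕_ (g≡G x↭) (g≡G y↭)))
          (G-move-≤ (A ++ C) (B ++ C) (subst₂ _≤E_ (sym (sumE-++ _ B C)) (sym (sumE-++ _ A C))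
            (⊕-mono-≤ le ≤E-refl))))
        convex (inj₂ (v , B′ , B↭ , le)) = inj₂ (v , yv , xv , subst₂ _≤E_
          (sym (cong₂ _⊕_ (g≡G Xv↭) (g≡G Yv↭))) (sym (cong₂ _⊕_ (g≡G x↭) (g≡G yv↭)))
          (G-swap-≤ (A ++ C) (B′ ++ C) (subst₂ _≤E_ (regroup A B′ v u) (regroup A B′ u v)
            (⊕-mono-≤ le (≤E-reflexive (⊕-comm (row v C) (row u C)))))))
          where
          v∈B : v ∈ B
          v∈B = ∈-resp-↭ (↭-sym B↭) (here refl)
          yXv : y v ≡ true × X v ≡ false
          yXv with y v | X v | proj₂ (∈-filter⁻ (λ a → T? (y a ∧ not (X a))) {xs = Ns} v∈B)
          ... | true | false | _ = refl , refl
          yv = proj₁ yXv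
          Xv = proj₂ yXv
          v≢u : v ≢ u
          v≢u refl = case ≡-trans (sym yv) yu of λ ()
          xv : x v ≡ false
          xv = ≡-trans (sym (set-≢ x false v≢u)) Xv
          yv↭ : filterᵇ y Ns ↭ v ∷ B′ ++ C
          yv↭ = ↭-trans y↭ (++⁺ʳ C B↭)
          Xv↭ : filterᵇ (X [ v ≔ true ]) Ns ↭ v ∷ A ++ C
          Xv↭ = ↭-trans (filterᵇ-insert uniq (all∈ v) Xv) (prep v X↭)
          -- The support of `Y` is written in two ways with `v` in front, and `v` is then cancelled.
          Yv↭ : filterᵇ (Y [ v ≔ false ]) Ns ↭ u ∷ B′ ++ C
          Yv↭ = drop-∷ (↭-trans
            (↭-sym (filterᵇ-remove uniq (all∈ v) (≡-trans (set-≢ y true v≢u) yv)))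
            (↭-trans Y↭ (↭-trans (prep u (++⁺ʳ C B↭)) (swap u v refl))))
          regroup : ∀ as bs a b → (row a as ⊕ row b bs) ⊕ (row a C ⊕ row b C)
                                  ≡ row a (as ++ C) ⊕ row b (bs ++ C)
          regroup as bs a b = ≡-trans (interchange (row a as) _ _ _)
            (sym (cong₂ _⊕_ (sumE-++ _ as C) (sumE-++ _ bs C)))

      -- A converse of `G-swap-≤` for the lists `w ∷ []` and `[]`. Cancellation is legitimate here:
      -- lists with at most one element contain no pair, so every cancelled term is finite.
      G-pair-≤⁻ : ∀ {u v w} → G (v ∷ w ∷ []) ⊕ G (u ∷ []) ≤E G (u ∷ w ∷ []) ⊕ G (v ∷ []) →
        h₂ v w ≤E h₂ u w
      G-pair-≤⁻ {u} {v} {w} le = ⊕-cancelˡ-≤ (h₁ u + h₁ v) (⊕-cancelˡ-≤ _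
        (subst₂ _≤E_ (normalise v u (cong fin (ℝ.+-comm (h₁ v) (h₁ u)))) (normalise u v refl) le))
        where
        normalise : ∀ a b {s} → fin (h₁ a + h₁ b) ≡ s → G (a ∷ w ∷ []) ⊕ G (b ∷ [])
          ≡ (G (w ∷ []) ⊕ G []) ⊕ (s ⊕ h₂ a w)
        normalise a b refl = ≡-trans (G-∷-∷ a (w ∷ []) b [])
          (≡-trans (⊕-comm _ (G (w ∷ []) ⊕ G []))
            (cong (λ t → (G (w ∷ []) ⊕ G []) ⊕ (fin (h₁ a + h₁ b) ⊕ t))
              (≡-trans (⊕-identityʳ _) (⊕-identityʳ _))))

      MnatConvex⇒antiUltrametric : MnatConvex _≟_ g → ∀ {u v w} → u ≢ v → v ≢ w → u ≢ w →
        h₂ u w ≤E h₂ u v ⊎ h₂ w v ≤E h₂ u v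
      MnatConvex⇒antiUltrametric convex {u} {v} {w} u≢v v≢w u≢w =
        conclude (convex x y u (set-≡ _ u true) (set-≢ _ true u≢w))
        where
        ∅ = λ (_ : N) → false
        V = ∅ [ v ≔ true ]
        x = V [ u ≔ true ]
        y = ∅ [ w ≔ true ]
        singleton↭ : ∀ a → filterᵇ (∅ [ a ≔ true ]) Ns ↭ a ∷ []
        singleton↭ a = ↭-trans (filterᵇ-insert uniq (all∈ a) refl)
          (prep a (↭-reflexive (filterᵇ-none Ns)))
          where
          filterᵇ-none : ∀ (as : List N) → filterᵇ ∅ as ≡ []
          filterᵇ-none []       = refl
          filterᵇ-none (_ ∷ as) = filterᵇ-none as
        x↭ : filterᵇ x Ns ↭ u ∷ v ∷ []
        x↭ = ↭-trans (filterᵇ-insert uniq (all∈ u) (set-≢ ∅ true u≢v)) (prep u (singleton↭ v))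
        X↭ : filterᵇ (x [ u ≔ false ]) Ns ↭ v ∷ []
        X↭ = drop-∷ (↭-trans (↭-sym (filterᵇ-remove uniq (all∈ u) (set-≡ V u true))) x↭)
        Y↭ : filterᵇ (y [ u ≔ true ]) Ns ↭ u ∷ w ∷ []
        Y↭ = ↭-trans (filterᵇ-insert uniq (all∈ u) (set-≢ ∅ true u≢w)) (prep u (singleton↭ w))
        w≢u : w ≢ u
        w≢u = u≢w ∘ sym
        Xw : (x [ u ≔ false ]) w ≡ false
        Xw = ≡-trans (set-≢ x false w≢u) (≡-trans (set-≢ V true w≢u) (set-≢ ∅ true (v≢w ∘ sym)))
        Yw : (y [ u ≔ true ]) w ≡ true
        Yw = ≡-trans (set-≢ y true w≢u) (set-≡ ∅ w true)
        Xw↭ : filterᵇ (x [ u ≔ false ] [ w ≔ true ]) Ns ↭ w ∷ v ∷ []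
        Xw↭ = ↭-trans (filterᵇ-insert uniq (all∈ w) Xw) (prep w X↭)
        Yw↭ : filterᵇ (y [ u ≔ true ] [ w ≔ false ]) Ns ↭ u ∷ []
        Yw↭ = drop-∷ (↭-trans
          (↭-sym (filterᵇ-remove uniq (all∈ w) Yw))
          (↭-trans Y↭ (swap u w refl)))
        conclude : _ → h₂ u w ≤E h₂ u v ⊎ h₂ w v ≤E h₂ u v
        -- Moving `u` alone turns {u,v}, {w} into {v}, {u,w}. Read the other way, `v` is traded for
        -- `w` beside `u`.
        conclude (inj₁ le) = inj₁ (subst₂ _≤E_ (h₂-sym w u) (h₂-sym v u) (G-pair-≤⁻
          (subst₂ _≤E_
            (≡-trans (cong₂ _⊕_ (g≡G X↭) (g≡G (↭-trans Y↭ (swap u w refl)))) (⊕-comm (G (v ∷ [])) _))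
            (cong₂ _⊕_ (g≡G (↭-trans x↭ (swap u v refl))) (g≡G (singleton↭ w)))
            le)))
        -- The partner comes from y = {w}, so it is `w`, and `u` is traded for `w` beside `v`.
        conclude (inj₂ (w′ , yw′ , _ , le)) with w′ ≟ w
        ... | yes refl = inj₂ (G-pair-≤⁻ (subst₂ _≤E_
                (cong₂ _⊕_ (g≡G Xw↭) (g≡G Yw↭)) (cong₂ _⊕_ (g≡G x↭) (g≡G (singleton↭ w))) le))
        ... | no _ = case yw′ of λ ()

  -- The minimum of two extended reals.

  minE-sel : ∀ x y → minE x y ≡ x ⊎ minE x y ≡ y
  minE-sel x y with x ≤E? y
  ... | yes _ = inj₁ refl
  ... | no  _ = inj₂ refl

  minE-≤ˡ : ∀ x y → minE x y ≤E x
  minE-≤ˡ x y with x ≤E? y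
  ... | yes _   = ≤E-refl
  ... | no  x≰y with ≤E-total x y
  ...   | inj₁ x≤y = contradiction x≤y x≰y
  ...   | inj₂ y≤x = y≤x

  minE-≤ʳ : ∀ x y → minE x y ≤E y
  minE-≤ʳ x y with x ≤E? y
  ... | yes x≤y = x≤y
  ... | no  _   = ≤E-refl

  minE-≤⇒⊎ : ∀ {x y z} → minE x y ≤E z → x ≤E z ⊎ y ≤E z
  minE-≤⇒⊎ {x} {y} {z} le with minE-sel x y
  ... | inj₁ eq = inj₁ (subst (_≤E z) eq le)
  ... | inj₂ eq = inj₂ (subst (_≤E z) eq le)

  ⊎⇒minE-≤ : ∀ {x y z} → x ≤E z ⊎ y ≤E z → minE x y ≤E z
  ⊎⇒minE-≤ {x} {y} (inj₁ le) = ≤E-trans (minE-≤ˡ x y) le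
  ⊎⇒minE-≤ {x} {y} (inj₂ le) = ≤E-trans (minE-≤ʳ x y) le

  -- The completion of a multipartite family of entries.

  module Completion {r : ℕ} (d : Fin r → ℕ) (c₂ : (i j : Fin r) → Fin (d i) → Fin (d j) → Ext)
    (c₂-nonneg : ∀ i j → i ≢ j → ∀ a b → fin 0ℝ ≤E c₂ i j a b)
    (c₂-sym : ∀ i j → i ≢ j → ∀ a b → c₂ i j a b ≡ c₂ j i b a) where
    open Problem d c₂

    module _ (v : Fin 4 → Ext) where
      private
        v₀ = v zero
        v₁ = v (suc zero)
        v₂ = v (suc (suc zero))
        v₃ = v (suc (suc (suc zero)))

      min4-≤ : ∀ p → min4 v ≤E v p
      min4-≤ zero                   = ≤E-trans (minE-≤ˡ (minE v₀ v₁) (minE v₂ v₃)) (minE-≤ˡ v₀ v₁)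
      min4-≤ (suc zero)             = ≤E-trans (minE-≤ˡ (minE v₀ v₁) (minE v₂ v₃)) (minE-≤ʳ v₀ v₁)
      min4-≤ (suc (suc zero))       = ≤E-trans (minE-≤ʳ (minE v₀ v₁) (minE v₂ v₃)) (minE-≤ˡ v₂ v₃)
      min4-≤ (suc (suc (suc zero))) = ≤E-trans (minE-≤ʳ (minE v₀ v₁) (minE v₂ v₃)) (minE-≤ʳ v₂ v₃)

      min4-attained : ∃[ p ] v p ≡ min4 v
      min4-attained with minE-sel (minE v₀ v₁) (minE v₂ v₃) | minE-sel v₀ v₁ | minE-sel v₂ v₃
      ... | inj₁ eq | inj₁ eq′ | _        = _ , sym (≡-trans eq eq′)
      ... | inj₁ eq | inj₂ eq′ | _        = _ , sym (≡-trans eq eq′)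
      ... | inj₂ eq | _        | inj₁ eq′ = _ , sym (≡-trans eq eq′)
      ... | inj₂ eq | _        | inj₂ eq′ = _ , sym (≡-trans eq eq′)

    MinTwice : (Fin 4 → Ext) → Set
    MinTwice v = ∃[ p ] ∃[ q ] (p ≢ q × v p ≡ min4 v × v q ≡ min4 v)

    -- A form of `MinTwice` that does not name the minimum, so that it can be compared with the
    -- anti-ultrametric inequality one entry at a time.
    NoStrictMin : (Fin 4 → Ext) → Set
    NoStrictMin v = ∀ p → ∃[ q ] (p ≢ q × v q ≤E v p)

    minTwice⇒noStrictMin : ∀ {v} → MinTwice v → NoStrictMin v
    minTwice⇒noStrictMin {v} (p , q , p≢q , vp , vq) s with s ≟F p
    ... | yes refl = q , p≢q , ≤E-reflexive (≡-trans vq (sym vp))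
    ... | no  s≢p  = p , s≢p , subst (_≤E v s) (sym vp) (min4-≤ v s)

    noStrictMin⇒minTwice : ∀ {v} → NoStrictMin v → MinTwice v
    noStrictMin⇒minTwice {v} noStrict with min4-attained v
    ... | p , vp with noStrict p
    ...   | q , p≢q , vq≤vp = p , q , p≢q , vp ,
            ≤E-antisym (subst (v q ≤E_) vp vq≤vp) (min4-≤ v q)

    Ulist-complete : ∀ u → u ∈ Ulist
    Ulist-complete (i , a) =
      ∈-concatMap⁺ (λ i → map (i ,_) (allFin (d i))) (lose (∈-allFin i) (∈-map⁺ (i ,_) (∈-allFin a)))

    Ulist-unique : Unique Ulist
    Ulist-unique = Uniqueₚ.concat⁺
      (Allₚ.map⁺ (All.universal (λ i → Uniqueₚ.map⁺ (λ { refl → refl }) (Uniqueₚ.allFin⁺ (d i))) _))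
      (AllPairsₚ.map⁺ (AllPairs.map disjoint (Uniqueₚ.allFin⁺ r)))
      where
      disjoint : ∀ {i j} → i ≢ j → Disjoint (map (i ,_) (allFin (d i))) (map (j ,_) (allFin (d j)))
      disjoint i≢j (u∈i , u∈j) with ∈-map⁻ _ u∈i | ∈-map⁻ _ u∈j
      ... | _ , _ , refl | _ , _ , refl = i≢j refl

    -- The value 0 inside a part is neutral for the maximum of nonnegative entries in h.
    cross : U → U → Ext
    cross (i , a) (j , b) with i ≟F j
    ... | yes _ = fin 0ℝ
    ... | no  _ = c₂ i j a b

    cross-≢ : ∀ {i j} a b → i ≢ j → cross (i , a) (j , b) ≡ c₂ i j a b
    cross-≢ {i} {j} a b i≢j with i ≟F j
    ... | yes i≡j = contradiction i≡j i≢j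
    ... | no  _   = refl

    -- Bottleneck values of the two-step paths from `u` to `v`. For `u` and `v` in one part and `w`
    -- in another, each is a lower bound that the anti-ultrametric inequality forces on the missing
    -- entry.
    links : U → U → List Ext
    links u v = map (λ w → cross u w ⊓ cross v w) Ulist

    h : U → U → Ext
    h (i , a) (j , b) with i ≟F j
    ... | no _ = c₂ i j a b
    ... | yes refl with a ≟F b
    ...   | yes _ = ∞
    -- The least value allowed by these bounds and by nonnegativity.
    ...   | no  _ = max (fin 0ℝ) (links (i , a) (j , b))

    h-cross : ∀ {i j} → i ≢ j → ∀ a b → h (i , a) (j , b) ≡ c₂ i j a b
    h-cross {i} {j} i≢j a b with i ≟F j
    ... | yes i≡j = contradiction i≡j i≢j
    ... | no  _   = refl

    h-diag : ∀ u → h u u ≡ ∞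
    h-diag (i , a) with i ≟F i
    ... | no i≢i = contradiction refl i≢i
    ... | yes refl with a ≟F a
    ...   | yes _   = refl
    ...   | no  a≢a = contradiction refl a≢a

    h-inner : ∀ {i} {a b : Fin (d i)} → a ≢ b → h (i , a) (i , b) ≡ max (fin 0ℝ) (links (i , a) (i , b))
    h-inner {i} {a} {b} a≢b with i ≟F i
    ... | no i≢i = contradiction refl i≢i
    ... | yes refl with a ≟F b
    ...   | yes a≡b = contradiction a≡b a≢b
    ...   | no  _   = refl

    -- A view of the three cases in `h`, which lets proofs rewrite with `h-diag`, `h-inner` and
    -- `h-cross`.
    data Position : U → U → Set where
      diagonal : ∀ {u} → Position u u
      inside   : ∀ {i a b} → a ≢ b → Position (i , a) (i , b)
      across   : ∀ {i j a b} → i ≢ j → Position (i , a) (j , b)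

    position : ∀ u v → Position u v
    position (i , a) (j , b) with i ≟F j
    ... | no i≢j = across i≢j
    ... | yes refl with a ≟F b
    ...   | yes refl = diagonal
    ...   | no  a≢b  = inside a≢b

    h-sym : ∀ u v → h u v ≡ h v u
    h-sym u v with position u v
    ... | diagonal   = refl
    ... | inside a≢b = ≡-trans (h-inner a≢b) (≡-trans
      (cong (max (fin 0ℝ)) (map-cong (λ w → ⊓-comm (cross u w) (cross v w)) Ulist))
      (sym (h-inner (a≢b ∘ sym))))
    ... | across {i} {j} {a} {b} i≢j =
      ≡-trans (h-cross i≢j a b) (≡-trans (c₂-sym i j i≢j a b) (sym (h-cross (i≢j ∘ sym) b a)))

    h-nonneg : ∀ u v → fin 0ℝ ≤E h u v
    h-nonneg u v with position u v
    ... | diagonal   = subst (fin 0ℝ ≤E_) (sym (h-diag u)) (_ ≤∞)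
    ... | inside a≢b = subst (fin 0ℝ ≤E_) (sym (h-inner a≢b)) (⊥≤max (fin 0ℝ) (links u v))
    ... | across i≢j = subst (fin 0ℝ ≤E_) (sym (h-cross i≢j _ _)) (c₂-nonneg _ _ i≢j _ _)

    -- The vertex `(j , e)` is one of the candidates in the maximum that defines the inner entry.
    h-via : ∀ {i j m} → i ≢ j → ∀ {a b} e → a ≢ b → m ≤E c₂ i j a e → m ≤E c₂ i j b e →
      m ≤E h (i , a) (i , b)
    h-via {i} {j} {m} i≢j {a} {b} e a≢b m≤a m≤b = subst (m ≤E_) (sym (h-inner a≢b)) (≤E-trans
      (⊓-glb (subst (m ≤E_) (sym (cross-≢ a e i≢j)) m≤a) (subst (m ≤E_) (sym (cross-≢ b e i≢j)) m≤b))
      (All.lookup (xs≤max (fin 0ℝ) (links (i , a) (i , b)))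
        (∈-map⁺ (λ w → cross (i , a) w ⊓ cross (i , b) w) (Ulist-complete (j , e)))))

    Via : ∀ {i} → Fin (d i) → Fin (d i) → Ext → Set
    Via {i} a b m = m ≤E fin 0ℝ ⊎ ∃₂ λ j e → i ≢ j × m ≤E c₂ i j a e × m ≤E c₂ i j b e

    -- The maximum is attained either by its default 0 or by some link; a link through the part `i`
    -- itself also has value 0.
    h-attained : ∀ {i} {a b : Fin (d i)} → a ≢ b → Via a b (h (i , a) (i , b))
    h-attained {i} {a} {b} a≢b rewrite h-inner a≢b
      with argmax-sel id (fin 0ℝ) (links (i , a) (i , b))
    ... | inj₁ eq = inj₁ (≤E-reflexive eq)
    ... | inj₂ m∈ with ∈-map⁻ _ m∈
    ...   | (j , e) , _ , eq with i ≟F j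
    ...     | yes _   = inj₁ (subst (_≤E fin 0ℝ) (sym eq) (x⊓y≤x (fin 0ℝ) (fin 0ℝ)))
    ...     | no  i≢j = inj₂ (j , e , i≢j ,
              subst (_≤E c₂ i j a e) (sym eq) (x⊓y≤x (c₂ i j a e) (c₂ i j b e)) ,
              subst (_≤E c₂ i j b e) (sym eq) (x⊓y≤y (c₂ i j a e) (c₂ i j b e)))

    -- Sufficiency: the completion is anti-ultrametric.

    module _ (jwp : JWP) (zfree : ZFree) where

      -- The triangle with `a`, `c` in one part and `b` in another. Let `(k , e)` attain the inner
      -- entry of `a`, `c`. If `k` is a third part, the JWP is applied to `a`, `b`, `e` and then to
      -- `b`, `e`, `c`. If `k` is `j`, either `e` is `b` or Z-freeness applies to the 4-cycle on
      -- `a`, `c` and `b`, `e`.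
      mixed : ∀ {i j} → i ≢ j → ∀ {a c} b → a ≢ c →
        h (i , a) (i , c) ≤E c₂ i j a b ⊎ c₂ i j c b ≤E c₂ i j a b
      mixed {i} {j} i≢j {a} {c} b a≢c with h-attained a≢c
      ... | inj₁ ≤0 = inj₁ (≤E-trans ≤0 (c₂-nonneg i j i≢j a b))
      ... | inj₂ (k , e , i≢k , ≤ae , ≤ce) with j ≟F k
      ...   | no j≢k with minE-≤⇒⊎ (jwp i j k i≢j j≢k i≢k a b e)
      ...     | inj₂ ae≤ab = inj₁ (≤E-trans ≤ae ae≤ab)
      ...     | inj₁ be≤ab with minE-≤⇒⊎ (jwp j k i j≢k (i≢k ∘ sym) (i≢j ∘ sym) b e c)
      ...       | inj₁ ec≤be = inj₁ (≤E-trans ≤ce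
                    (≤E-trans (subst (_≤E c₂ j k b e) (c₂-sym k i (i≢k ∘ sym) e c) ec≤be) be≤ab))
      ...       | inj₂ bc≤be = inj₂
                    (≤E-trans (subst (_≤E c₂ j k b e) (c₂-sym j i (i≢j ∘ sym) b c) bc≤be) be≤ab)
      mixed {i} {j} i≢j {a} {c} b a≢c | inj₂ (k , e , i≢k , ≤ae , ≤ce) | yes refl with b ≟F e
      ... | yes refl = inj₁ ≤ae
      ... | no  b≢e with minTwice⇒noStrictMin (zfree i j i≢j a c a≢c b e b≢e) zero
      ...   | zero                , 0≢0 , _  = contradiction refl 0≢0
      ...   | suc zero            , _   , le = inj₁ (≤E-trans ≤ae le)
      ...   | suc (suc zero)      , _   , le = inj₂ le
      ...   | suc (suc (suc zero)) , _  , le = inj₁ (≤E-trans ≤ce le)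

      -- The triangle inside one part. A vertex `e` attaining the entry of `c`, `b` is linked to `a`
      -- with value at least `m` by `mixed`, so it also links `a` to `b`.
      inner : ∀ {i} {a b c : Fin (d i)} → a ≢ b → a ≢ c → c ≢ b → ∀ {m} →
        m ≤E h (i , a) (i , c) → m ≤E h (i , c) (i , b) → m ≤E h (i , a) (i , b)
      inner {i} {a} {b} {c} a≢b a≢c c≢b m≤ac m≤cb with h-attained c≢b
      ... | inj₁ ≤0 = ≤E-trans m≤cb (≤E-trans ≤0 (h-nonneg (i , a) (i , b)))
      ... | inj₂ (j , e , i≢j , ≤ce , ≤be) with mixed i≢j e a≢c
      ...   | inj₁ ac≤ae = h-via i≢j e a≢b (≤E-trans m≤ac ac≤ae) (≤E-trans m≤cb ≤be)
      ...   | inj₂ ce≤ae = h-via i≢j e a≢b (≤E-trans m≤cb (≤E-trans ≤ce ce≤ae)) (≤E-trans m≤cb ≤be)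

      h-antiUltrametric : AntiUltrametric h
      h-antiUltrametric u v w with position u v | position u w | position w v
      ... | diagonal | _        | _        = inj₁ (subst (h u w ≤E_) (sym (h-diag u)) (_ ≤∞))
      ... | _        | diagonal | _        = inj₂ ≤E-refl
      ... | _        | _        | diagonal = inj₁ ≤E-refl
      ... | inside _   | inside _   | across k≢j = contradiction refl k≢j
      ... | inside _   | across i≢k | inside _   = contradiction refl i≢k
      ... | across i≢j | inside _   | inside _   = contradiction refl i≢j
      ... | inside a≢b | inside a≢c | inside c≢b with ≤E-total (h u w) (h w v)
      ...   | inj₁ le = inj₁ (inner a≢b a≢c c≢b ≤E-refl le)
      ...   | inj₂ le = inj₂ (inner a≢b a≢c c≢b le ≤E-refl)
      -- Here `w` itself is a link between `u` and `v`.
      h-antiUltrametric (i , a) (_ , b) (k , c) | inside a≢b | across i≢k | across k≢i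
        rewrite h-cross i≢k a c | h-cross k≢i c b | c₂-sym k i k≢i c b
        with ≤E-total (c₂ i k a c) (c₂ i k b c)
      ... | inj₁ le = inj₁ (h-via i≢k c a≢b ≤E-refl le)
      ... | inj₂ le = inj₂ (h-via i≢k c a≢b le ≤E-refl)
      h-antiUltrametric (i , a) (j , b) (_ , c) | across i≢j | inside a≢c | across k≢j
        rewrite h-cross i≢j a b | h-cross k≢j c b = mixed i≢j b a≢c
      -- Again `mixed`, now with the two vertices of one part being `v` and `w`; symmetry turns the
      -- entries around.
      h-antiUltrametric (i , a) (j , b) (_ , c) | across i≢j | across i≢k | inside c≢b
        rewrite h-sym (j , c) (j , b) | h-cross i≢j a b | h-cross i≢k a c
          | c₂-sym i j i≢j a b | c₂-sym i j i≢k a c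
        with mixed (i≢j ∘ sym) a (c≢b ∘ sym)
      ... | inj₁ le = inj₂ le
      ... | inj₂ le = inj₁ le
      h-antiUltrametric (i , a) (j , b) (k , c) | across i≢j | across i≢k | across k≢j
        rewrite h-cross i≢j a b | h-cross i≢k a c | h-cross k≢j c b | c₂-sym k j k≢j c b
        with minE-≤⇒⊎ (jwp i j k i≢j (k≢j ∘ sym) i≢k a b c)
      ... | inj₁ le = inj₂ le
      ... | inj₂ le = inj₁ le

      completable : MnatCompletable d c₂
      -- Linear terms do not affect M♮-convexity, so zero coefficients are chosen.
      completable = h , h-sym , (λ i j → h-cross) , (λ _ → 0ℝ) ,
        Quadratic.antiUltrametric⇒MnatConvex _≟U_ Ulist Ulist-unique Ulist-complete
          (λ _ → 0ℝ) h h-sym h-nonneg h-antiUltrametric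

    -- Necessity: triangles give the JWP, 4-cycles give Z-freeness.

    module _ (completion : MnatCompletable d c₂) where
      private
        h₂ = proj₁ completion
        h₂-sym = proj₁ (proj₂ completion)
        h₂-cross = proj₁ (proj₂ (proj₂ completion))
        h₁ = proj₁ (proj₂ (proj₂ (proj₂ completion)))
        convex = proj₂ (proj₂ (proj₂ (proj₂ completion)))
        anti : ∀ {u v w} → u ≢ v → v ≢ w → u ≢ w → h₂ u w ≤E h₂ u v ⊎ h₂ w v ≤E h₂ u v
        anti = Quadratic.MnatConvex⇒antiUltrametric _≟U_ Ulist Ulist-unique Ulist-complete h₁ h₂ h₂-sym convex

      completable⇒JWP : JWP
      completable⇒JWP i j k i≢j j≢k i≢k a b c = ⊎⇒minE-≤ (case anti
        {i , a} {j , b} {k , c} (i≢j ∘ cong proj₁) (j≢k ∘ cong proj₁) (i≢k ∘ cong proj₁) of λ where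
          (inj₁ le) → inj₂ (subst₂ _≤E_ (h₂-cross i k i≢k a c) (h₂-cross i j i≢j a b) le)
          (inj₂ le) → inj₁ (subst₂ _≤E_ (≡-trans (h₂-sym _ _) (h₂-cross j k j≢k b c))
                                        (h₂-cross i j i≢j a b) le))

      -- The completed entry of `a`, `b` is a chord of the 4-cycle. The triangle `a`, `c`, `b`
      -- compares `c₂ i j a c` with `c₂ i j b c` or with the chord, and the triangle `a`, `b`, `e`
      -- compares the chord with the other two sides.
      cycle : ∀ {i j} → i ≢ j → ∀ {a b c e} → a ≢ b → c ≢ e → c₂ i j a e ≤E c₂ i j a c
        ⊎ c₂ i j b c ≤E c₂ i j a c ⊎ c₂ i j b e ≤E c₂ i j a c
      cycle {i} {j} i≢j {a} {b} {c} {e} a≢b c≢e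
        rewrite sym (h₂-cross i j i≢j a c) | sym (h₂-cross i j i≢j a e)
          | sym (h₂-cross i j i≢j b c) | sym (h₂-cross i j i≢j b e)
        with anti {i , a} {j , c} {i , b}
          (i≢j ∘ cong proj₁) (i≢j ∘ sym ∘ cong proj₁) (λ { refl → a≢b refl })
      ... | inj₂ bc≤ac = inj₂ (inj₁ bc≤ac)
      ... | inj₁ ab≤ac with anti {i , a} {i , b} {j , e}
          (λ { refl → a≢b refl }) (i≢j ∘ cong proj₁) (i≢j ∘ cong proj₁)
      ...   | inj₁ ae≤ab = inj₁ (≤E-trans ae≤ab ab≤ac)
      ...   | inj₂ eb≤ab = inj₂ (inj₂ (≤E-trans (subst (_≤E h₂ (i , a) (i , b)) (h₂-sym (j , e) (i , b)) eb≤ab) ab≤ac))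

      completable⇒ZFree : ZFree
      completable⇒ZFree i j i≢j a b a≢b c e c≢e = noStrictMin⇒minTwice λ where
        -- The four positions are carried into one another by exchanging `a` with `b` and `c` with
        -- `e`, so `cycle` serves for each.
        zero → case cycle i≢j a≢b c≢e of λ where
          (inj₁ le)        → suc zero , (λ ()) , le
          (inj₂ (inj₁ le)) → suc (suc zero) , (λ ()) , le
          (inj₂ (inj₂ le)) → suc (suc (suc zero)) , (λ ()) , le
        (suc zero) → case cycle i≢j a≢b (c≢e ∘ sym) of λ where
          (inj₁ le)        → zero , (λ ()) , le
          (inj₂ (inj₁ le)) → suc (suc (suc zero)) , (λ ()) , le
          (inj₂ (inj₂ le)) → suc (suc zero) , (λ ()) , le
        (suc (suc zero)) → case cycle i≢j (a≢b ∘ sym) c≢e of λ where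
          (inj₁ le)        → suc (suc (suc zero)) , (λ ()) , le
          (inj₂ (inj₁ le)) → zero , (λ ()) , le
          (inj₂ (inj₂ le)) → suc zero , (λ ()) , le
        (suc (suc (suc zero))) → case cycle i≢j (a≢b ∘ sym) (c≢e ∘ sym) of λ where
          (inj₁ le)        → suc (suc zero) , (λ ()) , le
          (inj₂ (inj₁ le)) → suc zero , (λ ()) , le
          (inj₂ (inj₂ le)) → zero , (λ ()) , le

theorem3 : (R : Reals) → let open WithReals R in
    (r : ℕ) → 2 ≤ℕ r →
    (d : Fin r → ℕ) → (∀ i → 2 ≤ℕ d i) →
    (c₁ : (i : Fin r) → Fin (d i) → ℝ) →
    (∀ i a → 0ℝ ≤ c₁ i a) →
    (c₂ : (i j : Fin r) → Fin (d i) → Fin (d j) → Ext) →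
    (∀ i j → i ≢ j → ∀ a b → fin 0ℝ ≤E c₂ i j a b) →
    (∀ i j → i ≢ j → ∀ a b → c₂ i j a b ≡ c₂ j i b a) →
    MnatCompletable d c₂ ⇔ (Problem.JWP d c₂ × Problem.ZFree d c₂)
theorem3 R r _ d _ c₁ _ c₂ c₂-nonneg c₂-sym = mk⇔
  (λ completion → C.completable⇒JWP completion , C.completable⇒ZFree completion)
  (λ (jwp , zfree) → C.completable jwp zfree)
  where module C = Completion R d c₂ c₂-nonneg c₂-sym
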